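{- Let $(E,\mathcal{V})$ be a Steiner system $S(5,8,24)$, and let $e,f\in E$ be distinct elements. Let $\mathcal{C}$ be the collection of all six-element subsets $C\subset E$ for which there exists a block $V\in\mathcal{V}$ with $|V\cap\{e,f\}|=1$ and $C\subset V$, and let $\mathcal{B}$ be the collection of all six-element subsets of $E$ that are not in $\mathcal{C}$. Then $M=(E,\mathcal{B})$ is a paving matroid of rank six on a ground set of size $24$, and the events $e\in X$ and $f\in X$ are positively correlated when $X\in\mathcal{B}$ is chosen uniformly at random, i.e. $\Pr(e\in X\mid f\in X)>\Pr(e\in X)$. In particular, $M$ is not balanced, and so there exists a paving matroid that is not balanced.
   Context: A Steiner system $S(5,8,24)$ is a pair $(E,\mathcal{V})$ with $|E|=24$ and $\mathcal{V}\subset 2^E$ a collection of blocks, each of size eight, such that each five-element subset of $E$ is contained in a unique block; such a system is known to exist. A matroid $M=(E,\mathcal{B})$ is given by a finite ground set $E$ and its collection of bases $\mathcal{B}\subseteq 2^E$; all bases have the same size $r$, the rank of $M$. A subset of $E$ is independent if it is contained in some basis. A loop is an element contained in no basis; a coloop is an element contained in every basis. $M$ of rank $r$ is paving if all $(r-1)$-element subsets of $E$ are independent. If $g\in E$ is neither a loop nor a coloop, the deletion $M\setminus g$ has ground set $E\setminus\{g\}$ and bases $\{X\subseteq E\setminus\{g\}: X\in\mathcal{B}\}$; the contraction $M/g$ has ground set $E\setminus\{g\}$ and bases $\{X\subseteq E\setminus\{g\}: X\cup\{g\}\in\mathcal{B}\}$. A minor of $M$ is any matroid obtained from $M$ by a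 (possibly empty) series of deletions and contractions. A matroid has the negative correlation property if $\Pr(a\in X\mid b\in X)\le\Pr(a\in X)$ for all distinct ground set elements $a,b$ with $b$ not a loop, where $X$ is a uniformly random basis. A matroid is balanced if all its minors (including itself) have the negative correlation property. -}

module Defs where

open import Data.Fin using (Fin)
open import Data.Fin.Subset
  using (Subset; inside; outside; _∈_; _∉_; _⊆_; _∩_; _∪_; _-_; ⁅_⁆; ∣_∣)
open import Data.Fin.Subset.Properties using (_∈?_; _⊆?_; anySubset?)
open import Data.Integer using (+_)
open import Data.List using (List; []; _∷_; _++_; map; filter; length)
open import Data.Nat using (ℕ; zero; suc; _≟_)
open import Data.Product using (∃; ∃!; _×_)
open import Data.Rational using (ℚ; 0ℚ; _/_; _≤_)
open import Data.Vec using ([]; _∷_)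
open import Level using (Level; 0ℓ)
open import Relation.Binary.PropositionalEquality using (_≡_; _≢_)
open import Relation.Nullary using (¬_; ¬?; _×-dec_)
open import Relation.Unary using (Pred; Decidable)
open import Relation.Unary.Properties using (_∩?_)

private
  variable
    ℓ ℓ′ : Level
    n : ℕ

-- Ground sets are subsets of some Fin n, so that deleting or contracting an
-- element does not require relabelling the remaining ones.  Collections of
-- subsets are decidable predicates, so that their members can be counted.

------------------------------------------------------------------------
-- Steiner systems S(t,k,v)

record SteinerSystem (t k v n : ℕ) : Set₁ where
  field
    points     : Subset n
    Block      : Pred (Subset n) 0ℓ
    Block?     : Decidable Block
    ∣points∣≡v : ∣ points ∣ ≡ v
    block⊆     : ∀ {V} → Block V → V ⊆ points
    ∣block∣≡k  : ∀ {V} → Block V → ∣ V ∣ ≡ k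
    uniqueBlock : ∀ T → T ⊆ points → ∣ T ∣ ≡ t →
                  ∃! _≡_ λ V → Block V × T ⊆ V

------------------------------------------------------------------------
-- Matroids, presented by their bases

-- The data (E , ℬ) of a matroid, without the axioms.
record SetSystem (n : ℕ) : Set₁ where
  field
    ground : Subset n
    Basis  : Pred (Subset n) 0ℓ
    Basis? : Decidable Basis

open SetSystem public

record IsMatroid (M : SetSystem n) : Set where
  field
    basis⊆   : ∀ {X} → Basis M X → X ⊆ ground M
    nonempty : ∃ λ X → Basis M X
    exchange : ∀ {X Y} → Basis M X → Basis M Y →
               ∀ {x} → x ∈ X → x ∉ Y →
               ∃ λ y → y ∈ Y × y ∉ X × Basis M ((X - x) ∪ ⁅ y ⁆)

Independent : SetSystem n → Pred (Subset n) 0ℓ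
Independent M I = ∃ λ X → Basis M X × I ⊆ X

Loop : SetSystem n → Pred (Fin n) 0ℓ
Loop M g = g ∈ ground M × (∀ X → Basis M X → g ∉ X)

Coloop : SetSystem n → Pred (Fin n) 0ℓ
Coloop M g = g ∈ ground M × (∀ X → Basis M X → g ∈ X)

record IsPavingMatroid (M : SetSystem n) (r : ℕ) : Set where
  field
    isMatroid : IsMatroid M
    rank≡r    : ∀ {X} → Basis M X → ∣ X ∣ ≡ r
    -- suc ∣ I ∣ ≡ r rather than ∣ I ∣ ≡ r ∸ 1, as there are no sets of
    -- size r - 1 when r = 0.
    paving    : ∀ I → I ⊆ ground M → suc ∣ I ∣ ≡ r → Independent M I

infixl 6 _∖_ _⟋_

_∖_ : SetSystem n → Fin n → SetSystem n
ground (M ∖ g)   = ground M - g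
Basis  (M ∖ g) X = X ⊆ ground M - g × Basis M X
Basis? (M ∖ g) X = (X ⊆? ground M - g) ×-dec Basis? M X

_⟋_ : SetSystem n → Fin n → SetSystem n
ground (M ⟋ g)   = ground M - g
Basis  (M ⟋ g) X = X ⊆ ground M - g × Basis M (X ∪ ⁅ g ⁆)
Basis? (M ⟋ g) X = (X ⊆? ground M - g) ×-dec Basis? M (X ∪ ⁅ g ⁆)

data _IsMinorOf_ {n} (N : SetSystem n) : SetSystem n → Set₁ where
  itself   : N IsMinorOf N
  delete   : ∀ {M} g → g ∈ ground M → ¬ Loop M g → ¬ Coloop M g →
             N IsMinorOf (M ∖ g) → N IsMinorOf M
  contract : ∀ {M} g → g ∈ ground M → ¬ Loop M g → ¬ Coloop M g →
             N IsMinorOf (M ⟋ g) → N IsMinorOf M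

------------------------------------------------------------------------
-- Probability for a uniformly random basis

allSubsets : ∀ n → List (Subset n)
allSubsets zero    = [] ∷ []
allSubsets (suc n) =
  map (outside ∷_) (allSubsets n) ++ map (inside ∷_) (allSubsets n)

count : {P : Pred (Subset n) ℓ} → Decidable P → ℕ
count {n} P? = length (filter P? (allSubsets n))

-- Division by zero returns 0.  For a matroid, the denominator in Pr is
-- nonzero, and so is the one in CondPr when the condition is b ∈ X with b
-- a ground set element that is not a loop.
_÷_ : ℕ → ℕ → ℚ
m ÷ zero  = 0ℚ
m ÷ suc d = (+ m) / suc d

Pr : (M : SetSystem n) {P : Pred (Subset n) ℓ} → Decidable P → ℚ
Pr M P? = count (Basis? M ∩? P?) ÷ count (Basis? M)

-- CondPr M P? Q? is Pr(P | Q).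
CondPr : (M : SetSystem n) {P : Pred (Subset n) ℓ} {Q : Pred (Subset n) ℓ′} →
         Decidable P → Decidable Q → ℚ
CondPr M P? Q? = count (Basis? M ∩? (P? ∩? Q?)) ÷ count (Basis? M ∩? Q?)

NegativelyCorrelated : SetSystem n → Set
NegativelyCorrelated M =
  ∀ a b → a ∈ ground M → b ∈ ground M → a ≢ b → ¬ Loop M b →
  CondPr M (a ∈?_) (b ∈?_) ≤ Pr M (a ∈?_)

Balanced : SetSystem n → Set₁
Balanced M = ∀ N → N IsMinorOf M → NegativelyCorrelated N

------------------------------------------------------------------------
-- The set system built from S(5,8,24) and two of its points

module _ (S : SteinerSystem 5 8 24 n) (e f : Fin n) where
  open SteinerSystem S

  𝒞 : Pred (Subset n) 0ℓ
  𝒞 C = C ⊆ points × ∣ C ∣ ≡ 6 ×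
        ∃ λ V → Block V × ∣ V ∩ (⁅ e ⁆ ∪ ⁅ f ⁆) ∣ ≡ 1 × C ⊆ V

  𝒞? : Decidable 𝒞
  𝒞? C = (C ⊆? points) ×-dec (∣ C ∣ ≟ 6) ×-dec anySubset? λ V →
         Block? V ×-dec (∣ V ∩ (⁅ e ⁆ ∪ ⁅ f ⁆) ∣ ≟ 1) ×-dec (C ⊆? V)

  steinerMatroid : SetSystem n
  ground steinerMatroid   = points
  Basis  steinerMatroid X = X ⊆ points × ∣ X ∣ ≡ 6 × ¬ 𝒞 X
  Basis? steinerMatroid X =
    (X ⊆? points) ×-dec (∣ X ∣ ≟ 6) ×-dec ¬? (𝒞? X)

{-# OPTIONS --safe #-}
module Submission where

-- Double counting flags of k-sets inside blocks gives 253 blocks through a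
-- point and 77 through two points, hence 176 blocks through e and not f, and
-- as many through f and not e.  A six-set lies in at most one block, so 𝒞 has
-- 352 * 28 = 9856 members; 176 * 21 = 3696 of them contain e, as many contain
-- f, and none contains both.  This leaves 124740 bases: 29953 contain e, 29953
-- contain f and 7315 contain both, and 7315 * 124740 > 29953 * 29953.
-- Exchange and paving hold because a five-set lies in a single block V, and
-- adding to it a point outside V always gives a basis.  The words of weight
-- eight in the extended binary Golay code form an S(5,8,24).

open import Defs
open import Algebra.Properties.CommutativeSemigroup using (interchange)
open import Data.Bool using (Bool; true; false; T; _∧_; _xor_; if_then_else_)
open import Data.Bool.Properties using (T-∧) renaming (_≟_ to _≟ᵇ_)
open import Data.Fin using (Fin; zero; suc)
open import Data.Fin.Properties using (any?)
open import Data.Fin.Subset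
  using (Subset; inside; outside; _∈_; _∉_; _⊆_; _∩_; _∪_; _-_; ⁅_⁆; ⊥; ⊤; ∣_∣)
open import Data.Fin.Subset.Properties
  using (_∈?_; _⊆?_; anySubset?; drop-∷-⊆; out⊆; s⊆s; ⊥⊆; ∣⊥∣≡0; ∈⊤; ⊆⊤; ∣⊤∣≡n;
         x∈⁅x⁆; x∈⁅y⁆⇒x≡y; x≢y⇒x∉⁅y⁆; ∣⁅x⁆∣≡1; ⊆-refl; ⊆-trans; ⊆-antisym; p⊆q⇒∣p∣≤∣q∣;
         p∩q⊆q; x∈p∩q⁺; x∈p∩q⁻; ∪-identityʳ; ∪-comm; p⊆p∪q; q⊆p∪q; x∈p∪q⁻;
         p─⊥≡p; p─q⊆p; x∈p∧x≢y⇒x∈p-y)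
open import Data.List using (List; []; _∷_; _++_; map; filter; length; iterate)
open import Data.List.Membership.Propositional using () renaming (_∈_ to _∈ˡ_)
open import Data.List.Membership.Propositional.Properties using (∈-filter⁺; ∈-filter⁻)
open import Data.List.Properties
  using (filter-≐; filter-none; filter-all; filter-++; length-++; map-cong)
open import Data.List.Relation.Unary.All using (universal)
open import Data.List.Relation.Unary.Any using (here; there)
open import Data.Nat using (ℕ; zero; suc; _+_; _*_; _∸_; _<_; _≟_; _≡ᵇ_; z≤n; s≤s)
open import Data.Nat.Combinatorics using (_C_; nCk+nC[k+1]≡[n+1]C[k+1])
open import Data.Nat.ListAction using (sum)
open import Data.Nat.Properties
  using (≡ᵇ⇒≡; suc-injective; m+n∸m≡n; +-comm; +-suc; +-identityʳ; *-identityʳ;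
         *-cancelʳ-≡; +-commutativeSemigroup; ≤-reflexive; <⇒≱)
  renaming (_<?_ to _<ℕ?_)
open import Data.Product using (∃; ∃!; _×_; _,_; proj₁; proj₂)
open import Data.Rational using (_>_)
open import Data.Rational.Properties using (_<?_; <-≤-trans; <-irrefl)
open import Data.Sum using ([_,_]′)
open import Data.Vec using ([]; _∷_; init; last; tail; zipWith; replicate; here; there)
open import Data.Vec.Properties using (≡-dec)
open import Function using (_∘_; id; case_of_; Equivalence)
open import Level using (Level; 0ℓ)
open import Relation.Binary.PropositionalEquality
  using (_≡_; _≢_; refl; sym; trans; cong; cong₂; subst; subst₂; ≢-sym; module ≡-Reasoning)
open import Relation.Nullary
  using (¬_; Dec; yes; no; does; ¬?; _×-dec_; contradiction; from-yes; decidable-stable)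
open import Relation.Unary using (Pred; Decidable)
open import Relation.Unary.Properties using (_∩?_; ∁?)

private
  variable
    a b p q s : Level
    A : Set a
    B : Set b
    n : ℕ

-- Double counting

indicator : {P : Set p} → Dec P → ℕ
indicator P? = if does P? then 1 else 0

module _ {A : Set a} where

  length-filter-∷ : {P : Pred A p} (P? : Decidable P) (x : A) (xs : List A) →
    length (filter P? (x ∷ xs)) ≡ indicator (P? x) + length (filter P? xs)
  length-filter-∷ P? x xs with does (P? x)
  ... | true  = refl
  ... | false = refl

  length-filter≡sum : {P : Pred A p} (P? : Decidable P) (xs : List A) →
    length (filter P? xs) ≡ sum (map (indicator ∘ P?) xs)
  length-filter≡sum P? []       = refl
  length-filter≡sum P? (x ∷ xs) =
    trans (length-filter-∷ P? x xs) (cong (indicator (P? x) +_) (length-filter≡sum P? xs))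

  sum-map-0 : (xs : List A) → sum (map (λ _ → 0) xs) ≡ 0
  sum-map-0 []       = refl
  sum-map-0 (x ∷ xs) = sum-map-0 xs

  sum-map-+ : (f g : A → ℕ) (xs : List A) →
    sum (map (λ x → f x + g x) xs) ≡ sum (map f xs) + sum (map g xs)
  sum-map-+ f g []       = refl
  sum-map-+ f g (x ∷ xs) = trans (cong (f x + g x +_) (sum-map-+ f g xs))
    (interchange +-commutativeSemigroup (f x) (g x) (sum (map f xs)) (sum (map g xs)))

  sum-map-const-on : {P : Pred A p} (P? : Decidable P) {f : A → ℕ} {c : ℕ} →
    (∀ x → P x → f x ≡ c) → (∀ x → ¬ P x → f x ≡ 0) →
    (xs : List A) → sum (map f xs) ≡ length (filter P? xs) * c
  sum-map-const-on P? on off []       = refl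
  sum-map-const-on P? on off (x ∷ xs) with P? x
  ... | yes Px = cong₂ _+_ (on x Px) (sum-map-const-on P? on off xs)
  ... | no ¬Px = cong₂ _+_ (off x ¬Px) (sum-map-const-on P? on off xs)

  length-filter-map : {P : Pred B p} (P? : Decidable P) (f : A → B) (xs : List A) →
    length (filter P? (map f xs)) ≡ length (filter (P? ∘ f) xs)
  length-filter-map P? f []       = refl
  length-filter-map P? f (x ∷ xs) with does (P? (f x))
  ... | true  = cong suc (length-filter-map P? f xs)
  ... | false = length-filter-map P? f xs

module _ {A : Set a} {B : Set b} {R : A → B → Set s} (R? : ∀ x y → Dec (R x y)) where

  -- Both sides count the related pairs. Adding `x` to the rows raises each column by the indicator
  -- of its entry in that row.
  sum-length-filter-comm : (xs : List A) (ys : List B) →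
    sum (map (λ x → length (filter (R? x) ys)) xs) ≡
    sum (map (λ y → length (filter (λ x → R? x y) xs)) ys)
  sum-length-filter-comm []       ys = sym (sum-map-0 ys)
  sum-length-filter-comm (x ∷ xs) ys = begin
    length (filter (R? x) ys) + sum (map (λ x → length (filter (R? x) ys)) xs)
      ≡⟨ cong₂ _+_ (length-filter≡sum (R? x) ys) (sum-length-filter-comm xs ys) ⟩
    sum (map (indicator ∘ R? x) ys) + sum (map (λ y → length (filter (λ x → R? x y) xs)) ys)
      ≡⟨ sum-map-+ _ _ ys ⟨
    sum (map (λ y → indicator (R? x y) + length (filter (λ x → R? x y) xs)) ys)
      ≡⟨ cong sum (map-cong (λ y → length-filter-∷ (λ x → R? x y) x xs) ys) ⟨
    sum (map (λ y → length (filter (λ x → R? x y) (x ∷ xs))) ys) ∎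
    where open ≡-Reasoning

  module _ {P : Pred A p} {Q : Pred B q} (P? : Decidable P) (Q? : Decidable Q) where

    -- Related pairs are summed by rows and by columns. As `R` implies `P` and `Q`, rows outside `P`
    -- and columns outside `Q` are empty.
    double-counting : {c d : ℕ} → (∀ {x y} → R x y → P x × Q y) →
      (xs : List A) (ys : List B) →
      (∀ x → P x → length (filter (R? x) ys) ≡ c) →
      (∀ y → Q y → length (filter (λ x → R? x y) xs) ≡ d) →
      length (filter P? xs) * c ≡ length (filter Q? ys) * d
    double-counting {c} {d} R⇒ xs ys row column = begin
      length (filter P? xs) * c
        ≡⟨ sum-map-const-on P? row (λ x ¬Px → cong length
             (filter-none (R? x) (universal (λ y → ¬Px ∘ proj₁ ∘ R⇒) ys))) xs ⟨
      sum (map (λ x → length (filter (R? x) ys)) xs)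
        ≡⟨ sum-length-filter-comm xs ys ⟩
      sum (map (λ y → length (filter (λ x → R? x y) xs)) ys)
        ≡⟨ sum-map-const-on Q? column (λ y ¬Qy → cong length
             (filter-none (λ x → R? x y) (universal (λ x → ¬Qy ∘ proj₂ ∘ R⇒) xs))) ys ⟩
      length (filter Q? ys) * d ∎
      where open ≡-Reasoning

-- Counting subsets

module _ {P : Pred (Subset n) p} (P? : Decidable P) where

  count-none : (∀ X → ¬ P X) → count P? ≡ 0
  count-none ¬P = cong length (filter-none P? (universal ¬P (allSubsets n)))

  module _ {Q : Pred (Subset n) q} (Q? : Decidable Q) where

    count-cong : (∀ X → P X → Q X) → (∀ X → Q X → P X) → count P? ≡ count Q?
    count-cong P⇒Q Q⇒P =
      cong length (filter-≐ P? Q? ((λ {X} → P⇒Q X) , λ {X} → Q⇒P X) (allSubsets n))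

    count-split : count P? ≡ count (P? ∩? Q?) + count (P? ∩? ∁? Q?)
    count-split = go (allSubsets n)
      where
      go : ∀ Xs → length (filter P? Xs) ≡
                  length (filter (P? ∩? Q?) Xs) + length (filter (P? ∩? ∁? Q?) Xs)
      go []       = refl
      go (X ∷ Xs) with does (P? X) | does (Q? X)
      ... | true  | true  = cong suc (go Xs)
      ... | true  | false = trans (cong suc (go Xs)) (sym (+-suc _ _))
      ... | false | true  = go Xs
      ... | false | false = go Xs

  -- Existence over subsets is decidable, so a nonzero count yields a member without one being
  -- constructed; bases are found this way.
  count≢0⇒∃ : count P? ≢ 0 → ∃ P
  count≢0⇒∃ ≢0 = decidable-stable (anySubset? P?) λ ∄P →
    ≢0 (count-none λ X PX → ∄P (X , PX))

count-∷ : {P : Pred (Subset (suc n)) p} (P? : Decidable P) →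
  count P? ≡ count (P? ∘ (outside ∷_)) + count (P? ∘ (inside ∷_))
count-∷ {n = n} P? = begin
  length (filter P? (map (outside ∷_) Xs ++ map (inside ∷_) Xs))
    ≡⟨ cong length (filter-++ P? (map (outside ∷_) Xs) _) ⟩
  length (filter P? (map (outside ∷_) Xs) ++ filter P? (map (inside ∷_) Xs))
    ≡⟨ length-++ (filter P? (map (outside ∷_) Xs)) ⟩
  length (filter P? (map (outside ∷_) Xs)) + length (filter P? (map (inside ∷_) Xs))
    ≡⟨ cong₂ _+_ (length-filter-map P? _ Xs) (length-filter-map P? _ Xs) ⟩
  count (P? ∘ (outside ∷_)) + count (P? ∘ (inside ∷_)) ∎
  where
  open ≡-Reasoning
  Xs = allSubsets n

-- The lower bound lets one formula count the sets through no point, one point or two; `L = U`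
-- leaves at most a single set.
Between : Subset n → Subset n → ℕ → Pred (Subset n) 0ℓ
Between L U k X = L ⊆ X × X ⊆ U × ∣ X ∣ ≡ k

between? : (L U : Subset n) (k : ℕ) → Decidable (Between L U k)
between? L U k X = (L ⊆? X) ×-dec (X ⊆? U) ×-dec (∣ X ∣ ≟ k)

zero∉outside : {X : Subset n} → zero ∉ outside ∷ X
zero∉outside ()

-- Such a set is `L` with `j` of the `m` points of `U` outside `L`, and splitting on one of these
-- points gives Pascal's rule. Equations in place of differences avoid truncated subtraction.
count-between : (L U : Subset n) {m j k : ℕ} → L ⊆ U → ∣ L ∣ + m ≡ ∣ U ∣ → ∣ L ∣ + j ≡ k →
  count (between? L U k) ≡ m C j
count-between [] [] {j = zero}  L⊆U refl refl = refl
count-between [] [] {j = suc j} L⊆U refl refl = refl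
count-between (inside ∷ L) (outside ∷ U) L⊆U _ _ = contradiction (L⊆U here) zero∉outside
count-between (outside ∷ L) (outside ∷ U) {m} {j} {k} L⊆U m-eq j-eq = begin
  count (between? (outside ∷ L) (outside ∷ U) k)
    ≡⟨ count-∷ (between? (outside ∷ L) (outside ∷ U) k) ⟩
  _ ≡⟨ cong₂ _+_
         (count-cong (between? (outside ∷ L) (outside ∷ U) k ∘ (outside ∷_)) (between? L U k)
           (λ X (L⊆X , X⊆U , eq) → drop-∷-⊆ L⊆X , drop-∷-⊆ X⊆U , eq)
           (λ X (L⊆X , X⊆U , eq) → s⊆s L⊆X , s⊆s X⊆U , eq))
         (count-none (between? (outside ∷ L) (outside ∷ U) k ∘ (inside ∷_))
           (λ X (_ , X⊆U , _) → zero∉outside (X⊆U here))) ⟩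
  count (between? L U k) + 0
    ≡⟨ +-identityʳ _ ⟩
  count (between? L U k)
    ≡⟨ count-between L U (drop-∷-⊆ L⊆U) m-eq j-eq ⟩
  m C j ∎
  where open ≡-Reasoning
count-between (inside ∷ L) (inside ∷ U) {m} {j} L⊆U m-eq refl = begin
  count (between? (inside ∷ L) (inside ∷ U) (suc (∣ L ∣ + j)))
    ≡⟨ count-∷ (between? (inside ∷ L) (inside ∷ U) _) ⟩
  _ ≡⟨ cong₂ _+_
         (count-none (between? (inside ∷ L) (inside ∷ U) (suc (∣ L ∣ + j)) ∘ (outside ∷_))
           (λ X (L⊆X , _) → zero∉outside (L⊆X here)))
         (count-cong (between? (inside ∷ L) (inside ∷ U) (suc (∣ L ∣ + j)) ∘ (inside ∷_))
           (between? L U (∣ L ∣ + j))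
           (λ X (L⊆X , X⊆U , eq) → drop-∷-⊆ L⊆X , drop-∷-⊆ X⊆U , suc-injective eq)
           (λ X (L⊆X , X⊆U , eq) → s⊆s L⊆X , s⊆s X⊆U , cong suc eq)) ⟩
  count (between? L U (∣ L ∣ + j))
    ≡⟨ count-between L U (drop-∷-⊆ L⊆U) (suc-injective m-eq) refl ⟩
  m C j ∎
  where open ≡-Reasoning
-- Here `m` is zero although `U` has a point outside `L`, so `L` would be larger than the rest of
-- `U`.
count-between (outside ∷ L) (inside ∷ U) {zero} L⊆U m-eq j-eq =
  contradiction (p⊆q⇒∣p∣≤∣q∣ (drop-∷-⊆ L⊆U))
    (<⇒≱ (≤-reflexive (trans (sym m-eq) (+-identityʳ _))))
count-between (outside ∷ L) (inside ∷ U) {suc m} {zero} {k} L⊆U m-eq j-eq = begin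
  count (between? (outside ∷ L) (inside ∷ U) k)
    ≡⟨ count-∷ (between? (outside ∷ L) (inside ∷ U) k) ⟩
  _ ≡⟨ cong₂ _+_
         (count-cong (between? (outside ∷ L) (inside ∷ U) k ∘ (outside ∷_)) (between? L U k)
           (λ X (L⊆X , X⊆U , eq) → drop-∷-⊆ L⊆X , drop-∷-⊆ X⊆U , eq)
           (λ X (L⊆X , X⊆U , eq) → s⊆s L⊆X , out⊆ X⊆U , eq))
         -- With `j` zero, `L` already has `k` points and leaves no room for the extra one.
         (count-none (between? (outside ∷ L) (inside ∷ U) k ∘ (inside ∷_))
           (λ X (L⊆X , _ , eq) → contradiction (p⊆q⇒∣p∣≤∣q∣ (drop-∷-⊆ L⊆X))
           (<⇒≱ (≤-reflexive (trans eq (trans (sym j-eq) (+-identityʳ _))))))) ⟩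
  count (between? L U k) + 0
    ≡⟨ +-identityʳ _ ⟩
  count (between? L U k)
    ≡⟨ count-between L U (drop-∷-⊆ L⊆U)
         (suc-injective (trans (sym (+-suc ∣ L ∣ m)) m-eq)) j-eq ⟩
  m C 0 ∎
  where open ≡-Reasoning
count-between (outside ∷ L) (inside ∷ U) {suc m} {suc j} {k} L⊆U m-eq j-eq = begin
  count (between? (outside ∷ L) (inside ∷ U) k)
    ≡⟨ count-∷ (between? (outside ∷ L) (inside ∷ U) k) ⟩
  _ ≡⟨ cong₂ _+_
         (count-cong (between? (outside ∷ L) (inside ∷ U) k ∘ (outside ∷_)) (between? L U k)
           (λ X (L⊆X , X⊆U , eq) → drop-∷-⊆ L⊆X , drop-∷-⊆ X⊆U , eq)
           (λ X (L⊆X , X⊆U , eq) → s⊆s L⊆X , out⊆ X⊆U , eq))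
         (count-cong (between? (outside ∷ L) (inside ∷ U) k ∘ (inside ∷_)) (between? L U (∣ L ∣ + j))
           (λ X (L⊆X , X⊆U , eq) → drop-∷-⊆ L⊆X , drop-∷-⊆ X⊆U , suc-injective (trans eq k≡))
           (λ X (L⊆X , X⊆U , eq) → out⊆ L⊆X , s⊆s X⊆U , trans (cong suc eq) (sym k≡))) ⟩
  count (between? L U k) + count (between? L U (∣ L ∣ + j))
    ≡⟨ cong₂ _+_ (count-between L U (drop-∷-⊆ L⊆U) m≡ j-eq)
                 (count-between L U (drop-∷-⊆ L⊆U) m≡ refl) ⟩
  m C suc j + m C j
    ≡⟨ +-comm (m C suc j) (m C j) ⟩
  m C j + m C suc j
    ≡⟨ nCk+nC[k+1]≡[n+1]C[k+1] m j ⟩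
  suc m C suc j ∎
  where
  open ≡-Reasoning
  m≡ = suc-injective (trans (sym (+-suc ∣ L ∣ m)) m-eq)
  k≡ = trans (sym j-eq) (+-suc ∣ L ∣ j)

-- Only `Y` lies between `Y` and `Y`, and `0 C 0` is 1.
count-∃! : {P : Pred (Subset n) p} (P? : Decidable P) → ∃! _≡_ P → count P? ≡ 1
count-∃! {P = P} P? (Y , PY , unique) = trans
  (count-cong P? (between? Y Y ∣ Y ∣)
    (λ X PX → subst (Between Y Y ∣ Y ∣) (unique PX) (⊆-refl , ⊆-refl , refl))
    (λ X (Y⊆X , X⊆Y , _) → subst P (⊆-antisym Y⊆X X⊆Y) PY))
  (count-between Y Y ⊆-refl (+-identityʳ _) (+-identityʳ _))

-- The pairs X ⊆ V are counted once from each X, and m C j times from each V.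
count-covered : {P : Pred (Subset n) p} {Q : Pred (Subset n) q}
  (P? : Decidable P) (Q? : Decidable Q) (L : Subset n) {k m j : ℕ} →
  (∀ X → P X → L ⊆ X × ∣ X ∣ ≡ k × ∃! _≡_ λ V → Q V × X ⊆ V) →
  (∀ V → Q V → L ⊆ V × ∣ L ∣ + m ≡ ∣ V ∣) →
  (∀ X V → Q V → Between L V k X → P X) →
  ∣ L ∣ + j ≡ k →
  count P? ≡ count Q? * (m C j)
count-covered {n = n} P? Q? L {k} covered size below j-eq = trans (sym (*-identityʳ _))
  (double-counting (λ X V → P? X ×-dec Q? V ×-dec (X ⊆? V)) P? Q?
    (λ (PX , QV , _) → PX , QV) (allSubsets n) (allSubsets n)
    (λ X PX → let _ , _ , V , QV×X⊆V , unique = covered X PX in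
      count-∃! _ (V , (PX , QV×X⊆V) , unique ∘ proj₂))
    (λ V QV → let L⊆V , m-eq = size V QV in trans
      (count-cong _ (between? L V k)
        (λ X (PX , _ , X⊆V) → let L⊆X , eq , _ = covered X PX in L⊆X , X⊆V , eq)
        (λ X X∈ → below X V QV X∈ , QV , proj₁ (proj₂ X∈)))
      (count-between L V L⊆V m-eq j-eq)))

-- Sets meeting a pair in one point

∣p∪⁅x⁆∣ : (X : Subset n) (x : Fin n) → x ∉ X → ∣ X ∪ ⁅ x ⁆ ∣ ≡ suc ∣ X ∣
∣p∪⁅x⁆∣ (inside  ∷ X) zero    x∉X = contradiction here x∉X
∣p∪⁅x⁆∣ (outside ∷ X) zero    x∉X = cong (suc ∘ ∣_∣) (∪-identityʳ X)
∣p∪⁅x⁆∣ (inside  ∷ X) (suc x) x∉X = cong suc (∣p∪⁅x⁆∣ X x (x∉X ∘ there))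
∣p∪⁅x⁆∣ (outside ∷ X) (suc x) x∉X = ∣p∪⁅x⁆∣ X x (x∉X ∘ there)

∣p-x∣ : (X : Subset n) (x : Fin n) → x ∈ X → suc ∣ X - x ∣ ≡ ∣ X ∣
∣p-x∣ (inside  ∷ X) zero    here        = cong (suc ∘ ∣_∣) (p─⊥≡p X)
∣p-x∣ (inside  ∷ X) (suc x) (there x∈X) = cong suc (∣p-x∣ X x x∈X)
∣p-x∣ (outside ∷ X) (suc x) (there x∈X) = ∣p-x∣ X x x∈X

-- Finite search makes this constructive; with `X` empty it picks a point of a nonempty set.
∣p∣<∣q∣⇒∃ : (X Y : Subset n) → ∣ X ∣ < ∣ Y ∣ → ∃ λ y → y ∈ Y × y ∉ X
∣p∣<∣q∣⇒∃ X Y lt = decidable-stable (any? λ y → (y ∈? Y) ×-dec ¬? (y ∈? X)) λ ∄y →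
  contradiction (p⊆q⇒∣p∣≤∣q∣ {p = Y} {q = X} λ {y} y∈Y →
    decidable-stable (y ∈? X) λ y∉X → ∄y (y , y∈Y , y∉X))
  (<⇒≱ lt)

⁅x⁆⊆ : {x : Fin n} {X : Subset n} → x ∈ X → ⁅ x ⁆ ⊆ X
⁅x⁆⊆ {x = x} {X} x∈X y∈ = subst (_∈ X) (sym (x∈⁅y⁆⇒x≡y x y∈)) x∈X

∪-lub : {X Y Z : Subset n} → X ⊆ Z → Y ⊆ Z → X ∪ Y ⊆ Z
∪-lub {X = X} {Y} X⊆Z Y⊆Z z∈ = [ X⊆Z , Y⊆Z ]′ (x∈p∪q⁻ X Y z∈)

-- Stated by cardinality to match `𝒞`. For distinct `x` and `y` the lemmas below show that it means
-- containing exactly one of them.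
MeetsOnce : (x y : Fin n) → Pred (Subset n) 0ℓ
MeetsOnce x y X = ∣ X ∩ (⁅ x ⁆ ∪ ⁅ y ⁆) ∣ ≡ 1

meetsOnce⁺ : (x y : Fin n) (X : Subset n) → x ∈ X → y ∉ X → MeetsOnce x y X
meetsOnce⁺ x y X x∈X y∉X = trans (cong ∣_∣ (⊆-antisym
    (λ z∈ → let z∈X , z∈xy = x∈p∩q⁻ X _ z∈ in
      [ id , (λ z∈y → contradiction (subst (_∈ X) (x∈⁅y⁆⇒x≡y y z∈y) z∈X) y∉X) ]′
        (x∈p∪q⁻ ⁅ x ⁆ ⁅ y ⁆ z∈xy))
    (λ z∈x → x∈p∩q⁺ (⁅x⁆⊆ x∈X z∈x , p⊆p∪q ⁅ y ⁆ z∈x))))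
  (∣⁅x⁆∣≡1 x)

meetsOnce-sym : (x y : Fin n) (X : Subset n) → MeetsOnce x y X → MeetsOnce y x X
meetsOnce-sym x y X = subst (λ Y → ∣ X ∩ Y ∣ ≡ 1) (∪-comm ⁅ x ⁆ ⁅ y ⁆)

∣⁅x⁆∪⁅y⁆∣≡2 : (x y : Fin n) → x ≢ y → ∣ ⁅ x ⁆ ∪ ⁅ y ⁆ ∣ ≡ 2
∣⁅x⁆∪⁅y⁆∣≡2 x y x≢y = trans (∣p∪⁅x⁆∣ ⁅ x ⁆ y (x≢y⇒x∉⁅y⁆ (≢-sym x≢y))) (cong suc (∣⁅x⁆∣≡1 x))

meetsOnce⇒¬both : (x y : Fin n) (X : Subset n) → x ≢ y → MeetsOnce x y X → x ∈ X → y ∉ X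
meetsOnce⇒¬both x y X x≢y once x∈X y∈X = contradiction
  (trans (cong ∣_∣ (⊆-antisym (λ z∈ → x∈p∩q⁺ (∪-lub (⁅x⁆⊆ x∈X) (⁅x⁆⊆ y∈X) z∈ , z∈)) (p∩q⊆q X _)))
         once)
  (λ eq → case trans (sym (∣⁅x⁆∪⁅y⁆∣≡2 x y x≢y)) eq of λ ())

meetsOnce⇒¬neither : (x y : Fin n) (X : Subset n) → MeetsOnce x y X → x ∉ X → y ∈ X
meetsOnce⇒¬neither {n} x y X once x∉X =
  let z , z∈ , _  = ∣p∣<∣q∣⇒∃ (⊥ {n}) (X ∩ (⁅ x ⁆ ∪ ⁅ y ⁆)) (≤-reflexive (trans (cong suc (∣⊥∣≡0 n)) (sym once)))
      z∈X , z∈xy = x∈p∩q⁻ X _ z∈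
  in [ (λ z∈x → contradiction (subst (_∈ X) (x∈⁅y⁆⇒x≡y x z∈x) z∈X) x∉X)
     , (λ z∈y → subst (_∈ X) (x∈⁅y⁆⇒x≡y y z∈y) z∈X) ]′ (x∈p∪q⁻ ⁅ x ⁆ ⁅ y ⁆ z∈xy)

-- The counts 253 and 77 in S(5,8,24)

module Octads {n} (S : SteinerSystem 5 8 24 n) where
  open SteinerSystem S

  block-unique : ∀ {X V W} → X ⊆ points → ∣ X ∣ ≡ 5 →
    Block V → X ⊆ V → Block W → X ⊆ W → V ≡ W
  block-unique {X} X⊆ ∣X∣ BV X⊆V BW X⊆W =
    let _ , _ , unique = uniqueBlock X X⊆ ∣X∣ in
    trans (sym (unique (BV , X⊆V))) (unique (BW , X⊆W))

  -- Serves to show that a six-set of points lies in at most one block: five of its points already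
  -- determine the block.
  ∃-5-subset : ∀ X → ∣ X ∣ ≡ 6 → ∃ λ Y → Y ⊆ X × ∣ Y ∣ ≡ 5
  ∃-5-subset X ∣X∣≡6 =
    let x , x∈X , _ = ∣p∣<∣q∣⇒∃ (⊥ {n}) X (subst₂ _<_ (sym (∣⊥∣≡0 n)) (sym ∣X∣≡6) (s≤s z≤n))
    in X - x , p─q⊆p X ⁅ x ⁆ , suc-injective (trans (∣p-x∣ X x x∈X) ∣X∣≡6)

  -- Counts the pairs `X ⊆ V` with `V` a block and `X` a five-set through `L`; each `X` lies in one
  -- block. Here `j`, `m` and `o` count the points outside `L` of a five-set, a block and the ground
  -- set.
  count-blocks : (L : Subset n) → L ⊆ points → {j m o : ℕ} →
    ∣ L ∣ + j ≡ 5 → ∣ L ∣ + m ≡ 8 → ∣ L ∣ + o ≡ 24 →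
    o C j ≡ count (Block? ∩? (L ⊆?_)) * (m C j)
  count-blocks L L⊆ {j} {m} {o} j-eq m-eq o-eq = trans
    (sym (count-between L points L⊆ (trans o-eq (sym ∣points∣≡v)) j-eq))
    (count-covered (between? L points 5) (Block? ∩? (L ⊆?_)) L
      (λ X (L⊆X , X⊆ , ∣X∣) → let V , (BV , X⊆V) , unique = uniqueBlock X X⊆ ∣X∣ in
        L⊆X , ∣X∣ , V , ((BV , ⊆-trans L⊆X X⊆V) , X⊆V) , λ ((BW , _) , X⊆W) → unique (BW , X⊆W))
      (λ V (BV , L⊆V) → L⊆V , trans m-eq (sym (∣block∣≡k BV)))
      (λ X V (BV , _) (L⊆X , X⊆V , ∣X∣) → L⊆X , ⊆-trans X⊆V (block⊆ BV) , ∣X∣)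
      j-eq)

  module _ (x y : Fin n) (x∈ : x ∈ points) (y∈ : y ∈ points) (x≢y : x ≢ y) where

    blocks-∋ : count (Block? ∩? (x ∈?_)) ≡ 253
    blocks-∋ = trans
      (count-cong _ (Block? ∩? (⁅ x ⁆ ⊆?_))
        (λ V (BV , x∈V) → BV , ⁅x⁆⊆ x∈V) (λ V (BV , x⊆V) → BV , x⊆V (x∈⁅x⁆ x)))
      -- `23 C 4 = 8855 = 253 * 35`, with `35 = 7 C 4`.
      (*-cancelʳ-≡ _ 253 35 (sym (count-blocks ⁅ x ⁆ (⁅x⁆⊆ x∈)
        (cong (_+ 4) (∣⁅x⁆∣≡1 x)) (cong (_+ 7) (∣⁅x⁆∣≡1 x)) (cong (_+ 23) (∣⁅x⁆∣≡1 x)))))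

    blocks-∋∋ : count ((Block? ∩? (x ∈?_)) ∩? (y ∈?_)) ≡ 77
    blocks-∋∋ = trans
      (count-cong _ (Block? ∩? (⁅ x ⁆ ∪ ⁅ y ⁆ ⊆?_))
        (λ V ((BV , x∈V) , y∈V) → BV , ∪-lub (⁅x⁆⊆ x∈V) (⁅x⁆⊆ y∈V))
        (λ V (BV , xy⊆V) → (BV , xy⊆V (p⊆p∪q ⁅ y ⁆ (x∈⁅x⁆ x))) , xy⊆V (q⊆p∪q ⁅ x ⁆ _ (x∈⁅x⁆ y))))
      -- `22 C 3 = 1540 = 77 * 20`, with `20 = 6 C 3`.
      (*-cancelʳ-≡ _ 77 20 (sym (count-blocks (⁅ x ⁆ ∪ ⁅ y ⁆) (∪-lub (⁅x⁆⊆ x∈) (⁅x⁆⊆ y∈))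
        (cong (_+ 3) ∣xy∣) (cong (_+ 6) ∣xy∣) (cong (_+ 22) ∣xy∣))))
      where ∣xy∣ = ∣⁅x⁆∪⁅y⁆∣≡2 x y x≢y

    blocks-∋∌ : count ((Block? ∩? (x ∈?_)) ∩? ∁? (y ∈?_)) ≡ 176
    blocks-∋∌ = trans
      (sym (m+n∸m≡n (count (BlockAt? ∩? (y ∈?_))) _))
      (cong₂ _∸_ (trans (sym (count-split BlockAt? (y ∈?_))) blocks-∋) blocks-∋∋)
      where BlockAt? = Block? ∩? (x ∈?_)

-- The matroid of a Steiner system and two points

module SteinerMatroid {n} (S : SteinerSystem 5 8 24 n) (e f : Fin n)
  (e∈ : e ∈ SteinerSystem.points S) (f∈ : f ∈ SteinerSystem.points S) (e≢f : e ≢ f) where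

  open SteinerSystem S
  open Octads S

  M = steinerMatroid S e f

  -- Blocks meeting the pair once, and the resulting counts of bases

  Splitting : Pred (Subset n) 0ℓ
  Splitting V = Block V × MeetsOnce e f V

  splitting? : Decidable Splitting
  splitting? V = Block? V ×-dec (∣ V ∩ (⁅ e ⁆ ∪ ⁅ f ⁆) ∣ ≟ 1)

  splitting-∋e : count (splitting? ∩? (e ∈?_)) ≡ 176
  splitting-∋e = trans
    (count-cong _ ((Block? ∩? (e ∈?_)) ∩? ∁? (f ∈?_))
      (λ V ((BV , once) , e∈V) → (BV , e∈V) , meetsOnce⇒¬both e f V e≢f once e∈V)
      (λ V ((BV , e∈V) , f∉V) → (BV , meetsOnce⁺ e f V e∈V f∉V) , e∈V))
    (blocks-∋∌ e f e∈ f∈ e≢f)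

  splitting-∌e : count (splitting? ∩? ∁? (e ∈?_)) ≡ 176
  splitting-∌e = trans
    (count-cong _ ((Block? ∩? (f ∈?_)) ∩? ∁? (e ∈?_))
      (λ V ((BV , once) , e∉V) → (BV , meetsOnce⇒¬neither e f V once e∉V) , e∉V)
      (λ V ((BV , f∈V) , e∉V) → (BV , meetsOnce-sym f e V (meetsOnce⁺ f e V f∈V e∉V)) , e∉V))
    (blocks-∋∌ f e f∈ e∈ (≢-sym e≢f))

  splitting-∋f : count (splitting? ∩? (f ∈?_)) ≡ 176
  splitting-∋f = trans
    (count-cong _ (splitting? ∩? ∁? (e ∈?_))
      (λ V ((BV , once) , f∈V) → (BV , once) , λ e∈V → meetsOnce⇒¬both e f V e≢f once e∈V f∈V)
      (λ V ((BV , once) , e∉V) → (BV , once) , meetsOnce⇒¬neither e f V once e∉V))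
    splitting-∌e

  splitting-total : count splitting? ≡ 352
  splitting-total = trans (count-split splitting? (e ∈?_)) (cong₂ _+_ splitting-∋e splitting-∌e)

  -- Counts the pairs `X ⊆ V` with `X` in `𝒞` and `V` splitting, both through `L`. Five points of
  -- `X` fix `V`, so each `X` occurs once.
  count-𝒞 : (L : Subset n) {j m : ℕ} → ∣ L ∣ + j ≡ 6 → ∣ L ∣ + m ≡ 8 →
    count (𝒞? S e f ∩? (L ⊆?_)) ≡ count (splitting? ∩? (L ⊆?_)) * (m C j)
  count-𝒞 L j-eq m-eq = count-covered (𝒞? S e f ∩? (L ⊆?_)) (splitting? ∩? (L ⊆?_)) L
    (λ X ((X⊆ , ∣X∣ , V , BV , once , X⊆V) , L⊆X) →
      let Y , Y⊆X , ∣Y∣ = ∃-5-subset X ∣X∣ in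
      L⊆X , ∣X∣ , V , (((BV , once) , ⊆-trans L⊆X X⊆V) , X⊆V) ,
      λ (((BW , _) , _) , X⊆W) →
        block-unique (⊆-trans Y⊆X X⊆) ∣Y∣ BV (⊆-trans Y⊆X X⊆V) BW (⊆-trans Y⊆X X⊆W))
    (λ V ((BV , _) , L⊆V) → L⊆V , trans m-eq (sym (∣block∣≡k BV)))
    (λ X V ((BV , once) , _) (L⊆X , X⊆V , ∣X∣) →
      (⊆-trans X⊆V (block⊆ BV) , ∣X∣ , V , BV , once , X⊆V) , L⊆X)
    j-eq

  -- The six-sets of points are partitioned into `𝒞` and the bases. The truncated subtraction is
  -- exact, being read off from a sum.
  count-bases : (L : Subset n) → L ⊆ points → {j m o : ℕ} →
    ∣ L ∣ + j ≡ 6 → ∣ L ∣ + m ≡ 8 → ∣ L ∣ + o ≡ 24 →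
    count (Basis? M ∩? (L ⊆?_)) ≡ o C j ∸ count (splitting? ∩? (L ⊆?_)) * (m C j)
  count-bases L L⊆ {j} {m} {o} j-eq m-eq o-eq = begin
    count (Basis? M ∩? (L ⊆?_))
      ≡⟨ m+n∸m≡n (count (𝒞? S e f ∩? (L ⊆?_))) _ ⟨
    count (𝒞? S e f ∩? (L ⊆?_)) + count (Basis? M ∩? (L ⊆?_)) ∸ count (𝒞? S e f ∩? (L ⊆?_))
      ≡⟨ cong₂ _∸_ total (count-𝒞 L j-eq m-eq) ⟩
    o C j ∸ count (splitting? ∩? (L ⊆?_)) * (m C j) ∎
    where
    open ≡-Reasoning
    total : count (𝒞? S e f ∩? (L ⊆?_)) + count (Basis? M ∩? (L ⊆?_)) ≡ o C j
    total = begin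
      count (𝒞? S e f ∩? (L ⊆?_)) + count (Basis? M ∩? (L ⊆?_))
        ≡⟨ cong₂ _+_
             (count-cong (𝒞? S e f ∩? (L ⊆?_)) (between? L points 6 ∩? 𝒞? S e f)
               (λ X (𝒞X , L⊆X) → (L⊆X , proj₁ 𝒞X , proj₁ (proj₂ 𝒞X)) , 𝒞X)
               (λ X ((L⊆X , _) , 𝒞X) → 𝒞X , L⊆X))
             (count-cong (Basis? M ∩? (L ⊆?_)) (between? L points 6 ∩? ∁? (𝒞? S e f))
               (λ X ((X⊆ , ∣X∣ , ¬𝒞X) , L⊆X) → (L⊆X , X⊆ , ∣X∣) , ¬𝒞X)
               (λ X ((L⊆X , X⊆ , ∣X∣) , ¬𝒞X) → (X⊆ , ∣X∣ , ¬𝒞X) , L⊆X)) ⟩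
      count (between? L points 6 ∩? 𝒞? S e f) + count (between? L points 6 ∩? ∁? (𝒞? S e f))
        ≡⟨ count-split (between? L points 6) (𝒞? S e f) ⟨
      count (between? L points 6)
        ≡⟨ count-between L points L⊆ (trans o-eq (sym ∣points∣≡v)) j-eq ⟩
      o C j ∎

  bases-total : count (Basis? M) ≡ 124740
  bases-total = begin
    count (Basis? M)
      ≡⟨ count-cong (Basis? M) (Basis? M ∩? (⊥ ⊆?_)) (λ X BX → BX , ⊥⊆) (λ X → proj₁) ⟩
    count (Basis? M ∩? (⊥ ⊆?_))
      ≡⟨ count-bases ⊥ ⊥⊆ {6} {8} {24}
           (cong (_+ 6) (∣⊥∣≡0 n)) (cong (_+ 8) (∣⊥∣≡0 n)) (cong (_+ 24) (∣⊥∣≡0 n)) ⟩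
    24 C 6 ∸ count (splitting? ∩? (⊥ ⊆?_)) * (8 C 6)
      ≡⟨ cong (λ c → 24 C 6 ∸ c * (8 C 6)) (trans
           (count-cong (splitting? ∩? (⊥ ⊆?_)) splitting? (λ V → proj₁) (λ V SV → SV , ⊥⊆))
           splitting-total) ⟩
    24 C 6 ∸ 352 * (8 C 6) ∎
    where open ≡-Reasoning

  bases-∋ : (x : Fin n) → x ∈ points → count (splitting? ∩? (x ∈?_)) ≡ 176 →
    count (Basis? M ∩? (x ∈?_)) ≡ 29953
  bases-∋ x x∈ splitting-∋x = begin
    count (Basis? M ∩? (x ∈?_))
      ≡⟨ count-cong (Basis? M ∩? (x ∈?_)) (Basis? M ∩? (⁅ x ⁆ ⊆?_))
           (λ X (BX , x∈X) → BX , ⁅x⁆⊆ x∈X) (λ X (BX , x⊆X) → BX , x⊆X (x∈⁅x⁆ x)) ⟩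
    count (Basis? M ∩? (⁅ x ⁆ ⊆?_))
      ≡⟨ count-bases ⁅ x ⁆ (⁅x⁆⊆ x∈) {5} {7} {23}
           (cong (_+ 5) (∣⁅x⁆∣≡1 x)) (cong (_+ 7) (∣⁅x⁆∣≡1 x)) (cong (_+ 23) (∣⁅x⁆∣≡1 x)) ⟩
    23 C 5 ∸ count (splitting? ∩? (⁅ x ⁆ ⊆?_)) * (7 C 5)
      ≡⟨ cong (λ c → 23 C 5 ∸ c * (7 C 5)) (trans
           (count-cong (splitting? ∩? (⁅ x ⁆ ⊆?_)) (splitting? ∩? (x ∈?_))
             (λ V (SV , x⊆V) → SV , x⊆V (x∈⁅x⁆ x)) (λ V (SV , x∈V) → SV , ⁅x⁆⊆ x∈V))
           splitting-∋x) ⟩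
    23 C 5 ∸ 176 * (7 C 5) ∎
    where open ≡-Reasoning

  bases-∋e∋f : count (Basis? M ∩? ((e ∈?_) ∩? (f ∈?_))) ≡ 7315
  bases-∋e∋f = begin
    count (Basis? M ∩? ((e ∈?_) ∩? (f ∈?_)))
      ≡⟨ count-cong (Basis? M ∩? ((e ∈?_) ∩? (f ∈?_))) (Basis? M ∩? (⁅ e ⁆ ∪ ⁅ f ⁆ ⊆?_))
           (λ X (BX , e∈X , f∈X) → BX , ∪-lub (⁅x⁆⊆ e∈X) (⁅x⁆⊆ f∈X))
           (λ X (BX , ef⊆X) → BX , e∈⇐ ef⊆X , f∈⇐ ef⊆X) ⟩
    count (Basis? M ∩? (⁅ e ⁆ ∪ ⁅ f ⁆ ⊆?_))
      ≡⟨ count-bases (⁅ e ⁆ ∪ ⁅ f ⁆) (∪-lub (⁅x⁆⊆ e∈) (⁅x⁆⊆ f∈)) {4} {6} {22}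
           (cong (_+ 4) ∣ef∣) (cong (_+ 6) ∣ef∣) (cong (_+ 22) ∣ef∣) ⟩
    22 C 4 ∸ count (splitting? ∩? (⁅ e ⁆ ∪ ⁅ f ⁆ ⊆?_)) * (6 C 4)
      -- A splitting block never contains both `e` and `f`, so nothing is subtracted.
      ≡⟨ cong (λ c → 22 C 4 ∸ c * (6 C 4))
           (count-none (splitting? ∩? (⁅ e ⁆ ∪ ⁅ f ⁆ ⊆?_)) λ V ((_ , once) , ef⊆V) →
             meetsOnce⇒¬both e f V e≢f once (e∈⇐ ef⊆V) (f∈⇐ ef⊆V)) ⟩
    22 C 4 ∸ 0 * (6 C 4) ∎
    where
    open ≡-Reasoning
    ∣ef∣ = ∣⁅x⁆∪⁅y⁆∣≡2 e f e≢f
    e∈⇐ : ∀ {X} → ⁅ e ⁆ ∪ ⁅ f ⁆ ⊆ X → e ∈ X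
    e∈⇐ ef⊆X = ef⊆X (p⊆p∪q ⁅ f ⁆ (x∈⁅x⁆ e))
    f∈⇐ : ∀ {X} → ⁅ e ⁆ ∪ ⁅ f ⁆ ⊆ X → f ∈ X
    f∈⇐ ef⊆X = ef⊆X (q⊆p∪q ⁅ e ⁆ _ (x∈⁅x⁆ f))

  -- Positive correlation and failure of balance

  positivelyCorrelated : CondPr M (e ∈?_) (f ∈?_) > Pr M (e ∈?_)
  positivelyCorrelated = subst₂ _>_
    (cong₂ _÷_ (sym bases-∋e∋f) (sym (bases-∋ f f∈ splitting-∋f)))
    (cong₂ _÷_ (sym (bases-∋ e e∈ splitting-∋e)) (sym bases-total))
    -- Cross-multiplied, this is 912473100 > 897182209.
    (from-yes ((29953 ÷ 124740) <? (7315 ÷ 29953)))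

  -- Negative correlation is demanded only when the conditioning element is not a loop.
  ¬loop-f : ¬ Loop M f
  ¬loop-f (_ , f∉) =
    let X , BX , f∈X = count≢0⇒∃ (Basis? M ∩? (f ∈?_))
                         (λ eq → case trans (sym eq) (bases-∋ f f∈ splitting-∋f) of λ ())
    in f∉ X BX f∈X

  ¬balanced : ¬ Balanced M
  ¬balanced balanced =
    <-irrefl refl
      (<-≤-trans positivelyCorrelated (balanced M itself e f e∈ f∈ e≢f ¬loop-f))

  -- Independence of five-sets and basis exchange

  module _ {X V : Subset n} (X⊆ : X ⊆ points) (∣X∣ : ∣ X ∣ ≡ 5) (BV : Block V) (X⊆V : X ⊆ V) where

    -- A block containing `X ∪ ⁅ y ⁆` contains the five-set `X` and is therefore `V`, so `V` itself
    -- witnesses membership in `𝒞`.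
    𝒞-∪⁅⁆⇒ : ∀ y → 𝒞 S e f (X ∪ ⁅ y ⁆) → y ∈ V × MeetsOnce e f V
    𝒞-∪⁅⁆⇒ y (_ , _ , W , BW , once , Xy⊆W) =
      subst (λ W → y ∈ W × MeetsOnce e f W)
        (block-unique X⊆ ∣X∣ BW (⊆-trans (p⊆p∪q ⁅ y ⁆) Xy⊆W) BV X⊆V)
        (Xy⊆W (q⊆p∪q X _ (x∈⁅x⁆ y)) , once)

    ¬𝒞⇒basis : ∀ y → y ∈ points → y ∉ X → ¬ 𝒞 S e f (X ∪ ⁅ y ⁆) → Basis M (X ∪ ⁅ y ⁆)
    ¬𝒞⇒basis y y∈ y∉X ¬𝒞 =
      ∪-lub X⊆ (⁅x⁆⊆ y∈) , trans (∣p∪⁅x⁆∣ X y y∉X) (cong suc ∣X∣) , ¬𝒞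

    independent : Independent M X
    independent =
      -- A point outside the only block through `X` exists because 8 < 24.
      let y , y∈ , y∉V = ∣p∣<∣q∣⇒∃ V points
            (subst₂ _<_ (sym (∣block∣≡k BV)) (sym ∣points∣≡v) (from-yes (8 <ℕ? 24)))
      in X ∪ ⁅ y ⁆ , ¬𝒞⇒basis y y∈ (y∉V ∘ X⊆V) (y∉V ∘ proj₁ ∘ 𝒞-∪⁅⁆⇒ y) , p⊆p∪q ⁅ y ⁆

  -- With V the block containing X - x, failure of every exchange would put
  -- all of Y inside V, making Y a member of 𝒞.
  exchange : ∀ {X Y} → Basis M X → Basis M Y → ∀ {x} → x ∈ X → x ∉ Y →
    ∃ λ y → y ∈ Y × y ∉ X × Basis M ((X - x) ∪ ⁅ y ⁆)
  exchange {X} {Y} (X⊆ , ∣X∣ , _) (Y⊆ , ∣Y∣ , ¬𝒞Y) {x} x∈X x∉Y = decidable-stable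
    (any? λ y → (y ∈? Y) ×-dec ¬? (y ∈? X) ×-dec Basis? M (Z ∪ ⁅ y ⁆)) λ ∄y →
    let blocked : ∀ y → y ∈ Y → y ∉ X → 𝒞 S e f (Z ∪ ⁅ y ⁆)
        blocked = λ y y∈Y y∉X → decidable-stable (𝒞? S e f (Z ∪ ⁅ y ⁆)) λ ¬𝒞 →
          ∄y (y , y∈Y , y∉X , ¬𝒞⇒basis Z⊆ ∣Z∣ BV Z⊆V y (Y⊆ y∈Y) (y∉X ∘ p─q⊆p X ⁅ x ⁆) ¬𝒞)
        -- One blocked point suffices to show that `V` meets the pair once. `Y` has a point outside
        -- `Z` by size, and it is outside `X` too because `x` is not in `Y`.
        y₀ , y₀∈Y , y₀∉Z = ∣p∣<∣q∣⇒∃ Z Y (≤-reflexive (trans (cong suc ∣Z∣) (sym ∣Y∣)))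
        once = proj₂ (𝒞-∪⁅⁆⇒ Z⊆ ∣Z∣ BV Z⊆V y₀ (blocked y₀ y₀∈Y (y₀∉Z ∘ Y∩X⊆Z y₀∈Y)))
    in ¬𝒞Y (Y⊆ , ∣Y∣ , V , BV , once , λ {y} y∈Y → case y ∈? X of λ where
         (yes y∈X) → Z⊆V (Y∩X⊆Z y∈Y y∈X)
         (no  y∉X) → proj₁ (𝒞-∪⁅⁆⇒ Z⊆ ∣Z∣ BV Z⊆V y (blocked y y∈Y y∉X)))
    where
    Z = X - x
    Z⊆ : Z ⊆ points
    Z⊆ = ⊆-trans (p─q⊆p X ⁅ x ⁆) X⊆
    ∣Z∣ : ∣ Z ∣ ≡ 5
    ∣Z∣ = suc-injective (trans (∣p-x∣ X x x∈X) ∣X∣)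
    V = proj₁ (uniqueBlock Z Z⊆ ∣Z∣)
    BV = proj₁ (proj₁ (proj₂ (uniqueBlock Z Z⊆ ∣Z∣)))
    Z⊆V : Z ⊆ V
    Z⊆V = proj₂ (proj₁ (proj₂ (uniqueBlock Z Z⊆ ∣Z∣)))
    Y∩X⊆Z : ∀ {y} → y ∈ Y → y ∈ X → y ∈ Z
    Y∩X⊆Z y∈Y y∈X = x∈p∧x≢y⇒x∈p-y y∈X λ { refl → x∉Y y∈Y }

  isPavingMatroid : IsPavingMatroid M 6
  isPavingMatroid = record
    { isMatroid = record
      { basis⊆   = proj₁
      ; nonempty = count≢0⇒∃ (Basis? M) (λ eq → case trans (sym eq) bases-total of λ ())
      ; exchange = exchange
      }
    ; rank≡r = proj₁ ∘ proj₂
    ; paving = λ I I⊆ eq →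
        let ∣I∣ = suc-injective eq
            V , (BV , I⊆V) , _ = uniqueBlock I I⊆ ∣I∣
        in independent I⊆ ∣I∣ BV I⊆V
    }

-- The existence of S(5,8,24)

link : List (Subset (suc n)) → List (Subset n)
link []                  = []
link ((inside  ∷ V) ∷ Vs) = V ∷ link Vs
link ((outside ∷ V) ∷ Vs) = link Vs

-- Decides whether every k-subset lies in exactly one member.  Passing to the
-- link at each chosen point keeps the lists short, so that the 42504
-- five-subsets of 24 points are checked fast enough by evaluation.
coversOnce : ℕ → List (Subset n) → Bool
coversOnce             zero    Vs = length Vs ≡ᵇ 1
-- Vacuous: the empty set has no nonempty subsets.
coversOnce {n = zero}  (suc k) Vs = true
coversOnce {n = suc n} (suc k) Vs =
  coversOnce k (link Vs) ∧ coversOnce (suc k) (map tail Vs)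

∣p∣≡0⇒p⊆q : (X Y : Subset n) → ∣ X ∣ ≡ 0 → X ⊆ Y
∣p∣≡0⇒p⊆q (outside ∷ X) (_ ∷ Y) eq (there x∈X) = there (∣p∣≡0⇒p⊆q X Y eq x∈X)

length-filter-inside⊆ : (X : Subset n) (Vs : List (Subset (suc n))) →
  length (filter (inside ∷ X ⊆?_) Vs) ≡ length (filter (X ⊆?_) (link Vs))
length-filter-inside⊆ X []                  = refl
length-filter-inside⊆ X ((outside ∷ V) ∷ Vs) = length-filter-inside⊆ X Vs
length-filter-inside⊆ X ((inside  ∷ V) ∷ Vs) with does (X ⊆? V)
... | true  = cong suc (length-filter-inside⊆ X Vs)
... | false = length-filter-inside⊆ X Vs

length-filter-outside⊆ : (X : Subset n) (Vs : List (Subset (suc n))) →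
  length (filter (outside ∷ X ⊆?_) Vs) ≡ length (filter (X ⊆?_) (map tail Vs))
length-filter-outside⊆ X []             = refl
length-filter-outside⊆ X ((_ ∷ V) ∷ Vs) with does (X ⊆? V)
... | true  = cong suc (length-filter-outside⊆ X Vs)
... | false = length-filter-outside⊆ X Vs

-- Sets through the first point are counted in the link, the others after forgetting that
-- coordinate. Different entries may then acquire equal tails; lists keep such repetitions, so the
-- counts agree.
coversOnce-sound : (k : ℕ) (Vs : List (Subset n)) → T (coversOnce k Vs) →
  (X : Subset n) → ∣ X ∣ ≡ k → length (filter (X ⊆?_) Vs) ≡ 1
coversOnce-sound zero Vs covers X ∣X∣≡0 = trans
  (cong length (filter-all (X ⊆?_) (universal {P = X ⊆_} (λ V → ∣p∣≡0⇒p⊆q X V ∣X∣≡0) Vs)))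
  (≡ᵇ⇒≡ (length Vs) 1 covers)
coversOnce-sound (suc k) Vs covers (inside ∷ X) ∣X∣ = trans
  (length-filter-inside⊆ X Vs)
  (coversOnce-sound k (link Vs)
    (proj₁ (Equivalence.to T-∧ covers)) X (suc-injective ∣X∣))
coversOnce-sound (suc k) Vs covers (outside ∷ X) ∣X∣ = trans
  (length-filter-outside⊆ X Vs)
  (coversOnce-sound (suc k) (map tail Vs)
    (proj₂ (Equivalence.to (T-∧ {coversOnce k (link Vs)}) covers)) X ∣X∣)

-- Turns the numerical check into the Steiner axiom: any two solutions are entries of the same
-- one-element list.
length-filter≡1⇒∃! : {P : Pred A p} (P? : Decidable P) (xs : List A) →
  length (filter P? xs) ≡ 1 → ∃! _≡_ λ x → x ∈ˡ xs × P x
length-filter≡1⇒∃! P? xs eq with filter P? xs in filter≡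
length-filter≡1⇒∃! P? xs refl | x ∷ [] =
  x , ∈-filter⁻ P? (subst (x ∈ˡ_) (sym filter≡) (here refl)) ,
  λ (y∈xs , Py) → case subst (_ ∈ˡ_) filter≡ (∈-filter⁺ P? y∈xs Py) of λ where
    (here y≡x) → sym y≡x

steinerSystem : (t k : ℕ) (Vs : List (Subset n)) → (∀ {V} → V ∈ˡ Vs → ∣ V ∣ ≡ k) →
  T (coversOnce t Vs) → SteinerSystem t k n n
steinerSystem {n} t k Vs sizes covers = record
  { points      = ⊤
  ; Block       = _∈ˡ Vs
  ; Block?      = _∈ˡ? Vs
  ; ∣points∣≡v  = ∣⊤∣≡n n
  ; block⊆      = λ _ → ⊆⊤
  ; ∣block∣≡k   = sizes
  ; uniqueBlock = λ X _ ∣X∣ → length-filter≡1⇒∃! (X ⊆?_) Vs (coversOnce-sound t Vs covers X ∣X∣)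
  }
  where open import Data.List.Membership.DecPropositional (≡-dec _≟ᵇ_)
            using () renaming (_∈?_ to _∈ˡ?_)

-- The extended binary Golay code

linearSpan : List (Subset n) → List (Subset n)
linearSpan []       = ⊥ ∷ []
linearSpan (g ∷ gs) = linearSpan gs ++ map (zipWith _xor_ g) (linearSpan gs)

-- On coefficient vectors this is multiplication by x modulo x^(n+1) - 1. For a polynomial of degree
-- 11 and length 23, twelve shifts reach degree 22 without wrapping; their distinct degrees make
-- them independent.
rotate : Subset (suc n) → Subset (suc n)
rotate v = last v ∷ init v

-- The coefficients of 1 + x² + x⁴ + x⁵ + x⁶ + x¹⁰ + x¹¹, which generates the
-- binary Golay code of length 23.
golayPolynomial : Subset 23
golayPolynomial =
  inside ∷ outside ∷ inside ∷ outside ∷ inside ∷ inside ∷ inside ∷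
  outside ∷ outside ∷ outside ∷ inside ∷ inside ∷ replicate 11 outside

-- All these words have weight seven, so the parity bit put in front is 1.
extendedGolayCode : List (Subset 24)
extendedGolayCode = linearSpan (map (inside ∷_) (iterate rotate golayPolynomial 12))

octad? : Decidable λ (V : Subset 24) → ∣ V ∣ ≡ 8
octad? V = ∣ V ∣ ≟ 8

S⟨5,8,24⟩ : SteinerSystem 5 8 24 24
S⟨5,8,24⟩ = steinerSystem 5 8 (filter octad? extendedGolayCode)
  -- The final `_` is a proof of `T (coversOnce 5 ...)`, which evaluates to the unit type: the check
  -- over the 759 octads is a computation.
  (λ V∈ → proj₂ (∈-filter⁻ octad? {xs = extendedGolayCode} V∈)) _

mainTheorem2 : (∀ {n} (S : SteinerSystem 5 8 24 n) (e f : Fin n) →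
    e ∈ SteinerSystem.points S → f ∈ SteinerSystem.points S → e ≢ f →
    let M = steinerMatroid S e f in
    IsPavingMatroid M 6 ×
    ∣ ground M ∣ ≡ 24 ×
    CondPr M (e ∈?_) (f ∈?_) > Pr M (e ∈?_) ×
    ¬ Balanced M)
    × (∃ λ n → ∃ λ (M : SetSystem n) → ∃ λ r → IsPavingMatroid M r × ¬ Balanced M)
mainTheorem2 =
  (λ S e f e∈ f∈ e≢f → let open SteinerMatroid S e f e∈ f∈ e≢f in
    isPavingMatroid , SteinerSystem.∣points∣≡v S , positivelyCorrelated , ¬balanced) ,
  -- The two points are an arbitrary distinct pair; the first part covers every such pair.
  24 , G.M , 6 , G.isPavingMatroid , G.¬balanced
  where module G = SteinerMatroid S⟨5,8,24⟩ zero (suc zero) ∈⊤ ∈⊤ (λ ())
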